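{- Let $m\ge2$ be an integer, let $\lambda$ be an integer with $1\le\lambda\le m-1$, and let $\alpha<1+1/\lambda$. Consider makespan scheduling with predictions on $m$ identical machines under interval uncertainty. Then: (i) for no $\beta<\lambda$ is there a deterministic algorithm that is $\alpha$-consistent and $\beta$-robust; (ii) for no $\beta<\lambda/4$ is there a randomized algorithm that is $\alpha$-consistent and $\beta$-robust (in expectation).
   Context: There are $m$ machines and $n$ jobs. On identical machines a scenario is a vector of job sizes $p\in\mathbb R_{\ge0}^n$. A schedule is a partition $\mathcal S=(S_1,\dots,S_m)$ of $[n]$ (parts may be empty), and $C_{\max}(\mathcal S,p)=\max_{i}\sum_{j\in S_i}p_j$. $\mathrm{OPT}(p)=\min_{\mathcal S}C_{\max}(\mathcal S,p)$ and $\mathrm{OPT}^{\mathrm{rob}}(\mathcal U)=\min_{\mathcal S}\max_{p\in\mathcal U}C_{\max}(\mathcal S,p)$, minima over deterministic schedules. Interval uncertainty: for given $0\le p_j^-\le p_j^+$, $\mathcal U=\{p:p_j\in[p_j^-,p_j^+]\ \forall j\in[n]\}$. A deterministic algorithm maps each input $(\mathcal U,\hat p)$, where $\mathcal U$ is an interval uncertainty set (any number $n$ of jobs) and $\hat p\in\mathcal U$ is the predicted scenario, to a schedule $\mathcal S$. It is $\alpha$-consistent if $C_{\max}(\mathcal S,\hat p)\le\alpha\,\mathrm{OPT}(\hat p)$ for all inputs, and $\beta$-robust if $\max_{p\in\mathcal U}C_{\max}(\mathcal S,p)\le\beta\,\mathrm{OPT}^{\mathrm{rob}}(\mathcal U)$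 for all inputs. A randomized algorithm returns a random schedule $\mathcal S$; it is $\alpha$-consistent if $\mathbb E[C_{\max}(\mathcal S,\hat p)]\le\alpha\,\mathrm{OPT}(\hat p)$ and $\beta$-robust if $\mathbb E[C_{\max}(\mathcal S,p)]\le\beta\,\mathrm{OPT}^{\mathrm{rob}}(\mathcal U)$ for every $p\in\mathcal U$, for all inputs. No computational restriction is imposed. -}

module Defs where

open import Level using () renaming (suc to lsuc; _⊔_ to _⊔ˡ_)
open import Algebra.Apartness.Bundles using (HeytingField; HeytingCommutativeRing)
open import Algebra.Bundles using (CommutativeRing)
open import Algebra.Core using (Op₂)
import Algebra.Definitions.RawMonoid as RawMonoidDefs
import Algebra.Properties.Ring as RingProperties
open import Data.Bool.Base using (true; false; if_then_else_)
open import Data.Fin.Base using (Fin; zero; suc)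
open import Data.Fin.Properties using (_≟_)
open import Data.Nat.Base as ℕ using (ℕ; zero; suc; NonZero)
open import Data.Product.Base using (∃-syntax; _×_; _,_; proj₁; proj₂)
open import Data.Sum.Base using (_⊎_; inj₁; inj₂)
open import Data.Vec.Base as Vec using (Vec)
open import Data.Vec.Functional as Vector using (Vector)
open import Relation.Binary.Core using (Rel)
open import Relation.Binary.Lattice.Definitions using (Supremum; Infimum)
open import Relation.Binary.Structures using (IsStrictPartialOrder)
open import Relation.Nullary.Decidable.Core using (⌊_⌋)
open import Relation.Nullary.Negation.Core using (¬_; contradiction)

-- The real numbers, given by the axioms that characterise them: an
-- Archimedean, Cauchy-complete ordered field.  Classically every model is
-- isomorphic to ℝ.  The axioms are phrased so that they also hold
-- constructively: the order is not assumed decidable, x ≤ y means ¬ (y < x),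
-- and binary maxima and minima are part of the structure.
record RealNumbers c ℓ₁ ℓ₂ : Set (lsuc (c ⊔ˡ ℓ₁ ⊔ˡ ℓ₂)) where
  infix  4 _<_ _≤_
  infixr 7 _⊓_
  infixr 6 _⊔_

  field
    heytingField : HeytingField c ℓ₁ ℓ₂

  open HeytingField heytingField public hiding (zero)

  field
    _<_                  : Rel Carrier ℓ₂
    isStrictPartialOrder : IsStrictPartialOrder _≈_ _<_
    #⇒<⊎>                : ∀ {x y} → x # y → x < y ⊎ y < x
    <⇒#                  : ∀ {x y} → x < y → x # y
    +-monoˡ-<            : ∀ z {x y} → x < y → x + z < y + z
    *-pos                : ∀ {x y} → 0# < x → 0# < y → 0# < x * y

  _≤_ : Rel Carrier ℓ₂
  x ≤ y = ¬ (y < x)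

  field
    _⊔_        : Op₂ Carrier
    _⊓_        : Op₂ Carrier
    ⊔-supremum : Supremum _≤_ _⊔_
    ⊓-infimum  : Infimum _≤_ _⊓_

  commutativeRing : CommutativeRing c ℓ₁
  commutativeRing = HeytingCommutativeRing.commutativeRing heytingCommutativeRing

  open RawMonoidDefs (CommutativeRing.+-rawMonoid commutativeRing) public
    using (sum) renaming (_×_ to _·_)

  fromℕ : ℕ → Carrier
  fromℕ n = n · 1#

  abs : Carrier → Carrier
  abs x = x ⊔ (- x)

  field
    archimedean : ∀ x → ∃[ n ] x < fromℕ n
    complete    : (s : ℕ → Carrier) →
                  (∀ ε → 0# < ε →
                    ∃[ N ] ∀ i j → N ℕ.≤ i → N ℕ.≤ j → abs (s i - s j) < ε) →
                  ∃[ l ] ∀ ε → 0# < ε →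
                    ∃[ N ] ∀ i → N ℕ.≤ i → abs (s i - l) < ε

module RealProperties {c ℓ₁ ℓ₂} (ℝ : RealNumbers c ℓ₁ ℓ₂) where
  open RealNumbers ℝ

  private
    module < = IsStrictPartialOrder isStrictPartialOrder
    open RingProperties (CommutativeRing.ring commutativeRing)
      using (-1*x≈-x; -‿involutive)

  <-cotrans : ∀ {x y} → x < y → ∀ z → x < z ⊎ z < y
  <-cotrans x<y z with #-cotrans (<⇒# x<y) z
  ... | inj₁ x#z with #⇒<⊎> x#z
  ...   | inj₁ x<z = inj₁ x<z
  ...   | inj₂ z<x = inj₂ (<.trans z<x x<y)
  <-cotrans x<y z | inj₂ z#y with #⇒<⊎> z#y
  ...   | inj₁ z<y = inj₂ z<y
  ...   | inj₂ y<z = inj₁ (<.trans x<y y<z)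

  ≤-refl : ∀ {x} → x ≤ x
  ≤-refl = <.irrefl refl

  ≤-trans : ∀ {x y z} → x ≤ y → y ≤ z → x ≤ z
  ≤-trans {y = y} x≤y y≤z z<x with <-cotrans z<x y
  ... | inj₁ z<y = y≤z z<y
  ... | inj₂ y<x = x≤y y<x

  +-cancelʳ-< : ∀ z {x y} → x + z < y + z → x < y
  +-cancelʳ-< z {x} {y} x+z<y+z =
    <.<-respˡ-≈ (lem x) (<.<-respʳ-≈ (lem y) (+-monoˡ-< (- z) x+z<y+z))
    where
    lem : ∀ w → (w + z) + - z ≈ w
    lem w = trans (+-assoc w z (- z))
                  (trans (+-congˡ (-‿inverseʳ z)) (+-identityʳ w))

  +-mono-≤ : ∀ {x y u v} → x ≤ y → u ≤ v → x + u ≤ y + v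
  +-mono-≤ {x} {y} {u} {v} x≤y u≤v =
    ≤-trans {y = y + u}
      (λ lt → x≤y (+-cancelʳ-< u lt))
      (λ lt → u≤v (+-cancelʳ-< y
        (<.<-respˡ-≈ (+-comm y v) (<.<-respʳ-≈ (+-comm y u) lt))))

  ⊔-mono-≤ : ∀ {x y u v} → x ≤ y → u ≤ v → x ⊔ u ≤ y ⊔ v
  ⊔-mono-≤ {x} {y} {u} {v} x≤y u≤v =
    proj₂ (proj₂ (⊔-supremum x u)) (y ⊔ v)
      (≤-trans x≤y (proj₁ (⊔-supremum y v)))
      (≤-trans u≤v (proj₁ (proj₂ (⊔-supremum y v))))

  private
    x-0≈x : ∀ x → x - 0# ≈ x
    x-0≈x x = trans (sym (+-identityʳ _)) (trans (+-assoc _ _ _)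
                (trans (+-congˡ (-‿inverseˡ 0#)) (+-identityʳ x)))

  0<1 : 0# < 1#
  0<1 with #⇒<⊎> (invertible⇒# {1#} {0#} (1# , 1*[1-0]≈1 , [1-0]*1≈1))
    where
    1*[1-0]≈1 : 1# * (1# - 0#) ≈ 1#
    1*[1-0]≈1 = trans (*-identityˡ _) (x-0≈x 1#)
    [1-0]*1≈1 : (1# - 0#) * 1# ≈ 1#
    [1-0]*1≈1 = trans (*-identityʳ _) (x-0≈x 1#)
  ... | inj₂ 0<1′ = 0<1′
  ... | inj₁ 1<0  = contradiction (<.trans 1<0 0<1″) ≤-refl
    where
    0<-1 : 0# < - 1#
    0<-1 = <.<-respˡ-≈ (-‿inverseʳ 1#)
             (<.<-respʳ-≈ (+-identityˡ (- 1#)) (+-monoˡ-< (- 1#) 1<0))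
    0<1″ : 0# < 1#
    0<1″ = <.<-respʳ-≈ (trans (-1*x≈-x (- 1#)) (-‿involutive 1#))
             (*-pos 0<-1 0<-1)

  0<fromℕ : ∀ n .{{_ : NonZero n}} → 0# < fromℕ n
  0<fromℕ (suc n) = go n
    where
    go : ∀ k → 0# < fromℕ (suc k)
    go zero    = <.<-respʳ-≈ (sym (+-identityʳ 1#)) 0<1
    go (suc k) = <.trans (go k)
      (<.<-respˡ-≈ (+-identityˡ _) (+-monoˡ-< (fromℕ (suc k)) 0<1))

  recip : ∀ n .{{_ : NonZero n}} → Carrier
  recip n = proj₁ (#⇒invertible (#-sym (<⇒# (0<fromℕ n))))

  fromℕ*recip≈1 : ∀ n .{{_ : NonZero n}} → fromℕ n * recip n ≈ 1#
  fromℕ*recip≈1 n = trans (*-congʳ (sym (x-0≈x (fromℕ n))))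
    (proj₂ (proj₂ (#⇒invertible (#-sym (<⇒# (0<fromℕ n))))))

  maximum : ∀ {k} .{{_ : NonZero k}} → Vector Carrier k → Carrier
  maximum {suc k} x = Vector.foldr _⊔_ (Vector.head x) (Vector.tail x)

  minimum : ∀ {k} .{{_ : NonZero k}} → Vector Carrier k → Carrier
  minimum {suc k} x = Vector.foldr _⊓_ (Vector.head x) (Vector.tail x)

  sum-mono-≤ : ∀ {k} {x y : Vector Carrier k} →
               (∀ i → x i ≤ y i) → sum x ≤ sum y
  sum-mono-≤ {zero}  x≤y = ≤-refl
  sum-mono-≤ {suc k} x≤y = +-mono-≤ (x≤y zero) (sum-mono-≤ (λ i → x≤y (suc i)))

  maximum-mono-≤ : ∀ {k} .{{_ : NonZero k}} {x y : Vector Carrier k} →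
                   (∀ i → x i ≤ y i) → maximum x ≤ maximum y
  maximum-mono-≤ {suc k} {x = x} {y} x≤y = go (λ i → x≤y (suc i))
    where
    go : ∀ {l} {u v : Vector Carrier l} → (∀ i → u i ≤ v i) →
         Vector.foldr _⊔_ (x zero) u ≤ Vector.foldr _⊔_ (y zero) v
    go {zero}  u≤v = x≤y zero
    go {suc l} u≤v = ⊔-mono-≤ (u≤v zero) (go (λ i → u≤v (suc i)))

module Scheduling {c ℓ₁ ℓ₂} (ℝ : RealNumbers c ℓ₁ ℓ₂) where
  open RealNumbers ℝ
  open RealProperties ℝ

  -- A partition (S₁,…,Sₘ) of the jobs, parts possibly empty, is given by the
  -- machine to which each job is assigned: j ∈ Sᵢ iff lookup S j ≡ i.
  Schedule : ℕ → ℕ → Set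
  Schedule m n = Vec (Fin m) n

  load : ∀ {m n} → Schedule m n → Vector Carrier n → Fin m → Carrier
  load S p i = sum (λ j → if ⌊ Vec.lookup S j ≟ i ⌋ then p j else 0#)

  Cmax : ∀ {m n} .{{_ : NonZero m}} → Schedule m n → Vector Carrier n → Carrier
  Cmax S p = maximum (load S p)

  minSchedule : ∀ {m n} .{{_ : NonZero m}} → (Schedule m n → Carrier) → Carrier
  minSchedule {n = zero}  f = f Vec.[]
  minSchedule {n = suc n} f = minimum (λ i → minSchedule (λ S → f (i Vec.∷ S)))

  OPT : ∀ m .{{_ : NonZero m}} {n} → Vector Carrier n → Carrier
  OPT m p = minSchedule {m} (λ S → Cmax S p)

  record IntervalSet (n : ℕ) : Set (c ⊔ˡ ℓ₂) where
    field
      p⁻ p⁺ : Vector Carrier n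
      0≤p⁻  : ∀ j → 0# ≤ p⁻ j
      p⁻≤p⁺ : ∀ j → p⁻ j ≤ p⁺ j

  open IntervalSet public

  infix 4 _∈_
  _∈_ : ∀ {n} → Vector Carrier n → IntervalSet n → Set ℓ₂
  p ∈ U = ∀ j → p⁻ U j ≤ p j × p j ≤ p⁺ U j

  IsMaximumOver : ∀ {n} → IntervalSet n → (Vector Carrier n → Carrier) →
                  Carrier → Set (c ⊔ˡ ℓ₁ ⊔ˡ ℓ₂)
  IsMaximumOver U f v = (∃[ p ] p ∈ U × f p ≈ v) × (∀ p → p ∈ U → f p ≤ v)

  Cmax-mono-≤ : ∀ {m n} .{{_ : NonZero m}} (S : Schedule m n)
                {p q : Vector Carrier n} →
                (∀ j → p j ≤ q j) → Cmax S p ≤ Cmax S q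
  Cmax-mono-≤ S {p} {q} p≤q = maximum-mono-≤ (λ i → sum-mono-≤ (step i))
    where
    step : ∀ i j → (if ⌊ Vec.lookup S j ≟ i ⌋ then p j else 0#) ≤
                   (if ⌊ Vec.lookup S j ≟ i ⌋ then q j else 0#)
    step i j with ⌊ Vec.lookup S j ≟ i ⌋
    ... | true  = p≤q j
    ... | false = ≤-refl

  maxOver : ∀ {m n} .{{_ : NonZero m}} (U : IntervalSet n) (S : Schedule m n) →
            ∃[ v ] IsMaximumOver U (Cmax S) v
  maxOver U S = Cmax S (p⁺ U)
              , (p⁺ U , (λ j → p⁻≤p⁺ U j , ≤-refl) , refl)
              , (λ p p∈U → Cmax-mono-≤ S (λ j → proj₂ (p∈U j)))

  worstCase : ∀ {m n} .{{_ : NonZero m}} → IntervalSet n → Schedule m n → Carrier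
  worstCase U S = proj₁ (maxOver U S)

  OPTʳᵒᵇ : ∀ m .{{_ : NonZero m}} {n} → IntervalSet n → Carrier
  OPTʳᵒᵇ m U = minSchedule {m} (worstCase U)

  -- Algorithms need not respect _≈_: when equality of reals is a
  -- setoid, requiring that they do would constructively exclude most of them.
  DetAlgorithm : ℕ → Set (c ⊔ˡ ℓ₂)
  DetAlgorithm m = ∀ n (U : IntervalSet n) (p̂ : Vector Carrier n) →
                   p̂ ∈ U → Schedule m n

  -- There are only finitely many schedules, so a random schedule is, up to
  -- its law, a schedule-valued function on a finite probability space.
  record RandomSchedule (m n : ℕ) : Set (c ⊔ˡ ℓ₁ ⊔ˡ ℓ₂) where
    field
      size     : ℕ
      prob     : Vector Carrier size
      schedule : Vector (Schedule m n) size
      0≤prob   : ∀ ω → 0# ≤ prob ω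
      sum≈1    : sum prob ≈ 1#

    𝔼 : (Schedule m n → Carrier) → Carrier
    𝔼 f = sum (λ ω → prob ω * f (schedule ω))

  open RandomSchedule public

  RandAlgorithm : ℕ → Set (c ⊔ˡ ℓ₁ ⊔ˡ ℓ₂)
  RandAlgorithm m = ∀ n (U : IntervalSet n) (p̂ : Vector Carrier n) →
                    p̂ ∈ U → RandomSchedule m n

  module _ {m : ℕ} .{{_ : NonZero m}} where

    Consistent : Carrier → DetAlgorithm m → Set (c ⊔ˡ ℓ₂)
    Consistent α A = ∀ {n} (U : IntervalSet n) p̂ (p̂∈U : p̂ ∈ U) →
      Cmax (A n U p̂ p̂∈U) p̂ ≤ α * OPT m p̂

    Robust : Carrier → DetAlgorithm m → Set (c ⊔ˡ ℓ₂)
    Robust β A = ∀ {n} (U : IntervalSet n) p̂ (p̂∈U : p̂ ∈ U) →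
      worstCase U (A n U p̂ p̂∈U) ≤ β * OPTʳᵒᵇ m U

    ConsistentInExpectation : Carrier → RandAlgorithm m → Set (c ⊔ˡ ℓ₂)
    ConsistentInExpectation α A = ∀ {n} (U : IntervalSet n) p̂ (p̂∈U : p̂ ∈ U) →
      𝔼 (A n U p̂ p̂∈U) (λ S → Cmax S p̂) ≤ α * OPT m p̂

    RobustInExpectation : Carrier → RandAlgorithm m → Set (c ⊔ˡ ℓ₂)
    RobustInExpectation β A = ∀ {n} (U : IntervalSet n) p̂ (p̂∈U : p̂ ∈ U) →
      ∀ p → p ∈ U → 𝔼 (A n U p̂ p̂∈U) (λ S → Cmax S p) ≤ β * OPTʳᵒᵇ m U

{-# OPTIONS --safe #-}
module Submission where

open import Defs
open import Data.Nat.Base as ℕ using (ℕ; zero; suc; NonZero; z≤n; s≤s)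
open import Data.Product.Base using (∃; ∃-syntax; _×_; _,_; proj₁; proj₂)
open import Relation.Nullary.Negation.Core using (¬_; contradiction)
open import Algebra.Bundles using (CommutativeRing)
import Algebra.Properties.CommutativeMonoid.Sum as CommutativeMonoidSum
import Algebra.Properties.Semiring.Mult as SemiringMult
import Algebra.Properties.Semiring.Sum as SemiringSum
import Algebra.Solver.Ring.NaturalCoefficients.Default as RingSolver
open import Data.Bool.Base using (Bool; true; false; if_then_else_)
open import Data.Fin.Base as Fin using (Fin; zero; suc; _↑ˡ_; _↑ʳ_; inject≤; splitAt; fromℕ<)
open import Data.Fin.Properties
  using (_≟_; all?; ¬∀⟶∃¬; pigeonhole; inject≤-injective; suc-injective)
import Data.Nat.Properties as ℕ
open import Data.Nat.Solver using (module +-*-Solver)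
open import Data.Sum.Base using (_⊎_; inj₁; inj₂; [_,_]′)
import Data.Vec.Base as Vec
open import Data.Vec.Functional as Vector using (Vector; _++_; replicate)
open import Data.Vec.Functional.Properties using (lookup-++ˡ; lookup-++ʳ)
open import Data.Vec.Properties using (lookup∘tabulate)
open import Function.Base using (_∘_; const)
open import Function.Definitions using (Injective)
open import Relation.Binary.Definitions using (Trans)
open import Relation.Binary.PropositionalEquality as ≡
  using (_≡_; _≢_; cong; cong₂)
import Relation.Binary.Reasoning.Base.Triple as Triple
open import Relation.Binary.Structures using (IsPreorder; IsStrictPartialOrder)
open import Relation.Nullary.Decidable.Core using (⌊_⌋; yes; no)

-- Let r = m − 1 and k ≤ r. Take r jobs of certain size k and k small jobs with
-- interval [1, M], M = r k, predicted at 1. Then OPT(p̂) = k (all small jobs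
-- share a machine) and OPTʳᵒᵇ = M (all big jobs share a machine). Any schedule
-- either has predicted makespan at least k + 1 or puts all small jobs on one
-- machine, where they can reach k M. For a deterministic algorithm take k = λ.
-- For a randomized one take k = ⌈λ/2⌉: each schedule satisfies
-- Cmax(p⁺) + M (k − 1) Cmax(p̂) ≥ M k², hence so do the expectations, and
-- consistency leaves E[Cmax(p⁺)] ≥ M k (λ + 1 − k) / λ ≥ M λ / 4.

-- Machine loads over the natural numbers and the pigeonhole argument.

module NatLoad where
  open CommutativeMonoidSum ℕ.+-0-commutativeMonoid using (sum; sum-cong-≗) public

  -- Counterpart of `load` for natural sizes. The assignment is a function instead of a `Schedule`,
  -- so it can be restricted to a block of jobs by composition; `load-fromℕ` transfers the results
  -- to the reals.
  loadℕ : ∀ {m n} → Vector (Fin m) n → Vector ℕ n → Fin m → ℕ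
  loadℕ a w i = sum (λ j → if ⌊ a j ≟ i ⌋ then w j else 0)

  sum-split : ∀ k {l} (f : Vector ℕ (k ℕ.+ l)) →
              sum f ≡ sum (f ∘ (_↑ˡ l)) ℕ.+ sum (f ∘ (k ↑ʳ_))
  sum-split zero    f = ≡.refl
  sum-split (suc k) f =
    ≡.trans (cong (f zero ℕ.+_) (sum-split k (f ∘ suc))) (≡.sym (ℕ.+-assoc (f zero) _ _))

  loadℕ-cong : ∀ {m n} {a b : Vector (Fin m) n} {u v : Vector ℕ n} →
               (∀ j → a j ≡ b j) → (∀ j → u j ≡ v j) → ∀ i → loadℕ a u i ≡ loadℕ b v i
  loadℕ-cong a≗b u≗v i =
    sum-cong-≗ (λ j → cong₂ (λ x y → if ⌊ x ≟ i ⌋ then y else 0) (a≗b j) (u≗v j))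

  loadℕ-++ : ∀ {m k l} (a : Vector (Fin m) (k ℕ.+ l)) (u : Vector ℕ k) (v : Vector ℕ l) i →
             loadℕ a (u ++ v) i ≡ loadℕ (a ∘ (_↑ˡ l)) u i ℕ.+ loadℕ (a ∘ (k ↑ʳ_)) v i
  loadℕ-++ {k = k} a u v i = ≡.trans (sum-split k _)
    (cong₂ ℕ._+_ (loadℕ-cong {a = a ∘ (_↑ˡ _)} (λ _ → ≡.refl) (lookup-++ˡ u v) i)
                 (loadℕ-cong {a = a ∘ (k ↑ʳ_)} (λ _ → ≡.refl) (lookup-++ʳ u v) i))

  job≤loadℕ : ∀ {m n} (a : Vector (Fin m) n) w {i} j → a j ≡ i → w j ℕ.≤ loadℕ a w i
  job≤loadℕ a w {i} zero a₀≡i with a zero ≟ i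
  ... | yes _  = ℕ.m≤m+n _ _
  ... | no a≢i = contradiction a₀≡i a≢i
  job≤loadℕ a w (suc j) aⱼ≡i =
    ℕ.≤-trans (job≤loadℕ (a ∘ suc) (w ∘ suc) j aⱼ≡i) (ℕ.m≤n+m _ _)

  loadℕ-miss : ∀ {m n} (a : Vector (Fin m) n) w {i} → (∀ j → a j ≢ i) → loadℕ a w i ≡ 0
  loadℕ-miss {n = zero}  a w     a≢i = ≡.refl
  loadℕ-miss {n = suc n} a w {i} a≢i with a zero ≟ i
  ... | yes a₀≡i = contradiction a₀≡i (a≢i zero)
  ... | no _     = loadℕ-miss (a ∘ suc) (w ∘ suc) (a≢i ∘ suc)

  loadℕ-const≤ : ∀ {m n} (a : Vector (Fin m) n) c i → loadℕ a (const c) i ℕ.≤ n ℕ.* c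
  loadℕ-const≤ {n = zero}  a c i = z≤n
  loadℕ-const≤ {n = suc n} a c i with a zero ≟ i
  ... | yes _ = ℕ.+-monoʳ-≤ c (loadℕ-const≤ (a ∘ suc) c i)
  ... | no _  = ℕ.≤-trans (loadℕ-const≤ (a ∘ suc) c i) (ℕ.m≤n+m _ c)

  loadℕ-concentrated : ∀ {m n} (a : Vector (Fin m) n) c {i} → (∀ j → a j ≡ i) →
                       loadℕ a (const c) i ≡ n ℕ.* c
  loadℕ-concentrated {n = zero}  a c     a≡i = ≡.refl
  loadℕ-concentrated {n = suc n} a c {i} a≡i with a zero ≟ i
  ... | yes _   = cong (c ℕ.+_) (loadℕ-concentrated (a ∘ suc) c (a≡i ∘ suc))
  ... | no a₀≢i = contradiction (a≡i zero) a₀≢i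

  -- At most one job can land on `i`: once the first job does, injectivity makes all later jobs miss
  -- it.
  loadℕ-injective : ∀ {m n} (a : Vector (Fin m) n) c i → Injective _≡_ _≡_ a →
                    loadℕ a (const c) i ℕ.≤ c
  loadℕ-injective {n = zero}  a c i inj = z≤n
  loadℕ-injective {n = suc n} a c i inj with a zero ≟ i
  ... | yes ≡.refl = ℕ.≤-reflexive (≡.trans
          (cong (c ℕ.+_) (loadℕ-miss (a ∘ suc) (const c) (λ j eq → contradiction (inj eq) λ ())))
          (ℕ.+-identityʳ c))
  ... | no _       = loadℕ-injective (a ∘ suc) c i (suc-injective ∘ inj)

  two-jobs≤loadℕ : ∀ {m n} (a : Vector (Fin m) n) w {i} {j j′} → j ≢ j′ → a j ≡ i → a j′ ≡ i →
                   w j ℕ.+ w j′ ℕ.≤ loadℕ a w i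
  two-jobs≤loadℕ a w {j = zero} {zero} j≢j′ _ _ = contradiction ≡.refl j≢j′
  two-jobs≤loadℕ a w {i} {zero} {suc j′} _ p q with a zero ≟ i
  ... | yes _   = ℕ.+-monoʳ-≤ (w zero) (job≤loadℕ (a ∘ suc) (w ∘ suc) j′ q)
  ... | no a₀≢i = contradiction p a₀≢i
  two-jobs≤loadℕ a w {j = suc j} {zero} j≢j′ p q =
    ℕ.≤-trans (ℕ.≤-reflexive (ℕ.+-comm (w (suc j)) (w zero)))
              (two-jobs≤loadℕ a w {j = zero} {suc j} (λ ()) q p)
  two-jobs≤loadℕ a w {j = suc j} {suc j′} j≢j′ p q =
    ℕ.≤-trans (two-jobs≤loadℕ (a ∘ suc) (w ∘ suc) (j≢j′ ∘ cong suc) p q) (ℕ.m≤n+m _ _)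

  -- The r big jobs and two small jobs on different machines cannot all be
  -- on different machines, so a big job meets another job.
  overload⊎concentrated : ∀ {k′ r} → let k = suc k′ in
    (a : Vector (Fin (suc r)) k) (b : Vector (Fin (suc r)) r) →
    (∃[ i ] suc k ℕ.≤ loadℕ a (const 1) i ℕ.+ loadℕ b (const k) i) ⊎ (∀ j → a j ≡ a zero)
  overload⊎concentrated {k′} {r} a b with all? (λ j → a j ≟ a zero)
  ... | yes eq = inj₂ eq
  ... | no ¬eq with ¬∀⟶∃¬ _ _ (λ j → a j ≟ a zero) ¬eq
  ...   | j , aⱼ≢a₀ = inj₁ (collide (pigeonhole ℕ.≤-refl g))
    where
    k = suc k′
    g : Fin (suc (suc r)) → Fin (suc r)
    g zero          = a zero
    g (suc zero)    = a j
    g (suc (suc t)) = b t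

    small+big : ∀ {i} s t → a s ≡ i → b t ≡ i →
                suc k ℕ.≤ loadℕ a (const 1) i ℕ.+ loadℕ b (const k) i
    small+big s t p q = ℕ.+-mono-≤ (job≤loadℕ a (const 1) s p) (job≤loadℕ b (const k) t q)

    collide : (∃[ x ] ∃[ y ] x Fin.< y × g x ≡ g y) →
              ∃[ i ] suc k ℕ.≤ loadℕ a (const 1) i ℕ.+ loadℕ b (const k) i
    collide (zero , zero , () , _)
    collide (suc _ , zero , () , _)
    collide (suc zero , suc zero , s≤s () , _)
    collide (suc (suc _) , suc zero , s≤s () , _)
    collide (zero , suc zero , _ , eq) = contradiction (≡.sym eq) aⱼ≢a₀
    collide (zero , suc (suc t) , _ , eq) = _ , small+big zero t eq ≡.refl
    collide (suc zero , suc (suc t) , _ , eq) = _ , small+big j t eq ≡.refl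
    -- Two big jobs have total size `k + k`, which is at least `suc k` because `k` is positive.
    collide (suc (suc t) , suc (suc t′) , s≤s (s≤s t<t′) , eq) = _ ,
      ℕ.≤-trans (ℕ.+-monoˡ-≤ k (s≤s (z≤n {k′})))
        (ℕ.≤-trans (two-jobs≤loadℕ b (const k) {j = t} {t′}
                     (λ { ≡.refl → ℕ.<-irrefl ≡.refl t<t′ }) eq ≡.refl)
                   (ℕ.m≤n+m _ _))

-- The arithmetic behind the choice of k as half of λ, rounded up.

module Halving where
  open +-*-Solver

  -- With l = suc l′ and k = suc k′, the inequality is a rearrangement of
  -- l² ≤ 4 k (l + 1 − k), which holds for k = ⌈l/2⌉.
  half-suffices : ∀ l′ → ∃[ k′ ] k′ ℕ.≤ l′ ×
    suc l′ ℕ.* suc l′ ℕ.+ 4 ℕ.* (suc k′ ℕ.* (k′ ℕ.* suc (suc l′)))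
      ℕ.≤ 4 ℕ.* (suc l′ ℕ.* (suc k′ ℕ.* suc k′))
  half-suffices l′ with parity l′
    where
    parity : ∀ n → ∃[ h ] (n ≡ h ℕ.+ h ⊎ n ≡ suc (h ℕ.+ h))
    parity zero = 0 , inj₁ ≡.refl
    parity (suc n) with parity n
    ... | h , inj₁ ≡.refl = h , inj₂ ≡.refl
    ... | h , inj₂ ≡.refl = suc h , inj₁ (cong suc (≡.sym (ℕ.+-suc h h)))
  -- Here l = 2h + 1 and k = h + 1. The two sides differ by exactly 4h + 3, so adding this slack
  -- turns the inequality into a polynomial identity. In the other case l = 2h + 2 and the slack is
  -- 4h + 4.
  ... | h , inj₁ ≡.refl = h , ℕ.m≤m+n h h , ℕ.m+n≤o⇒m≤o _ (ℕ.≤-reflexive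
    (solve 1 (λ h → let l′ = h :+ h ; l = con 1 :+ l′ ; k = con 1 :+ h in
      l :* l :+ con 4 :* (k :* (h :* (con 1 :+ l))) :+ (con 4 :* h :+ con 3)
        := con 4 :* (l :* (k :* k))) ≡.refl h))
  ... | h , inj₂ ≡.refl = h , ℕ.m≤n⇒m≤1+n (ℕ.m≤m+n h h) , ℕ.m+n≤o⇒m≤o _ (ℕ.≤-reflexive
    (solve 1 (λ h → let l′ = con 1 :+ (h :+ h) ; l = con 1 :+ l′ ; k = con 1 :+ h in
      l :* l :+ con 4 :* (k :* (h :* (con 1 :+ l))) :+ (con 4 :* h :+ con 4)
        := con 4 :* (l :* (k :* k))) ≡.refl h))

-- Constructive order arithmetic, finite maxima and minima, and the embedding of the naturals.

module Order {c ℓ₁ ℓ₂} (ℝ : RealNumbers c ℓ₁ ℓ₂) where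
  open RealNumbers ℝ
  open RealProperties ℝ

  module < = IsStrictPartialOrder isStrictPartialOrder
  module R = CommutativeRing commutativeRing

  <⇒≤ : ∀ {x y} → x < y → x ≤ y
  <⇒≤ x<y y<x = <.irrefl refl (<.trans x<y y<x)

  ≤-reflexive : ∀ {x y} → x ≈ y → x ≤ y
  ≤-reflexive x≈y = <.irrefl (sym x≈y)

  -- Apartness is tight: two numbers that are not apart are equal, and being apart would make one of
  -- them strictly smaller.
  ≤-antisym : ∀ {x y} → x ≤ y → y ≤ x → x ≈ y
  ≤-antisym x≤y y≤x = proj₁ (tight _ _) (λ x#y → [ y≤x , x≤y ]′ (#⇒<⊎> x#y))

  <-≤-trans : Trans _<_ _≤_ _<_
  <-≤-trans {j = y} {k = z} x<y y≤z with <-cotrans x<y z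
  ... | inj₁ x<z = x<z
  ... | inj₂ z<y = contradiction z<y y≤z

  ≤-<-trans : Trans _≤_ _<_ _<_
  ≤-<-trans {i = x} x≤y y<z with <-cotrans y<z x
  ... | inj₁ y<x = contradiction y<x x≤y
  ... | inj₂ x<z = x<z

  ≤-isPreorder : IsPreorder _≈_ _≤_
  ≤-isPreorder = record
    { isEquivalence = isEquivalence ; reflexive = ≤-reflexive ; trans = ≤-trans }

  module ≤-Reasoning = Triple ≤-isPreorder
    (λ x<y y<x → <⇒≤ x<y y<x) <.trans <.<-resp-≈ <⇒≤ <-≤-trans ≤-<-trans

  *-monoʳ-< : ∀ {z x y} → 0# < z → x < y → z * x < z * y
  *-monoʳ-< {z} {x} {y} 0<z x<y = begin-strict
    z * x                    ≈⟨ +-identityˡ _ ⟨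
    0# + z * x               <⟨ +-monoˡ-< (z * x) (*-pos 0<z 0<y-x) ⟩
    z * (y - x) + z * x      ≈⟨ distribˡ z (y - x) x ⟨
    z * ((y - x) + x)        ≈⟨ *-congˡ (trans (+-assoc y (- x) x) (+-congˡ (-‿inverseˡ x))) ⟩
    z * (y + 0#)             ≈⟨ *-congˡ (+-identityʳ y) ⟩
    z * y                    ∎
    where
    open ≤-Reasoning
    0<y-x : 0# < y - x
    0<y-x = <.<-respˡ-≈ (-‿inverseʳ x) (+-monoˡ-< (- x) x<y)

  -- The conclusion is a negation, so both 0 ≤ z and x ≤ y may be split into
  -- the strict case and equality.
  *-monoʳ-≤ : ∀ {z x y} → 0# ≤ z → x ≤ y → z * x ≤ z * y
  *-monoʳ-≤ {z} {x} {y} 0≤z x≤y zy<zx = ¬¬0<z ¬0<z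
    where
    ¬0<z : ¬ (0# < z)
    ¬0<z 0<z = ≤-reflexive (*-congˡ x≈y) zy<zx
      where
      x≈y : x ≈ y
      x≈y = ≤-antisym x≤y (λ x<y → <⇒≤ (*-monoʳ-< 0<z x<y) zy<zx)
    ¬¬0<z : ¬ ¬ (0# < z)
    -- A refutation of `0# < z` is by definition a proof of `z ≤ 0#`, so `z` is zero and both
    -- products vanish.
    ¬¬0<z z≤0 = ≤-reflexive (trans (*-congʳ z≈0) (trans (R.zeroˡ x)
                (sym (trans (*-congʳ z≈0) (R.zeroˡ y))))) zy<zx
      where
      z≈0 : z ≈ 0#
      z≈0 = ≤-antisym z≤0 0≤z

  +-monoʳ-≤ : ∀ z {x y} → x ≤ y → z + x ≤ z + y
  +-monoʳ-≤ z = +-mono-≤ ≤-refl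

  maximum-upper : ∀ {k} .{{_ : NonZero k}} (x : Vector Carrier k) i → x i ≤ maximum x
  maximum-upper {suc k} x = λ { zero → base (x ∘ suc) ; (suc i) → step (x ∘ suc) i }
    where
    -- The head of the vector is the seed of the fold, so it is treated apart from the entries of
    -- the tail.
    base : ∀ {l} (u : Vector Carrier l) → x zero ≤ Vector.foldr _⊔_ (x zero) u
    base {zero}  u = ≤-refl
    base {suc l} u = ≤-trans (base (u ∘ suc)) (proj₁ (proj₂ (⊔-supremum _ _)))
    step : ∀ {l} (u : Vector Carrier l) i → u i ≤ Vector.foldr _⊔_ (x zero) u
    step u zero    = proj₁ (⊔-supremum _ _)
    step u (suc i) = ≤-trans (step (u ∘ suc) i) (proj₁ (proj₂ (⊔-supremum _ _)))

  maximum-least : ∀ {k} .{{_ : NonZero k}} (x : Vector Carrier k) {v} → (∀ i → x i ≤ v) →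
                  maximum x ≤ v
  maximum-least {suc k} x {v} x≤v = go (x ∘ suc) (x≤v ∘ suc)
    where
    go : ∀ {l} (u : Vector Carrier l) → (∀ i → u i ≤ v) → Vector.foldr _⊔_ (x zero) u ≤ v
    go {zero}  u u≤v = x≤v zero
    go {suc l} u u≤v = proj₂ (proj₂ (⊔-supremum _ _)) v (u≤v zero) (go (u ∘ suc) (u≤v ∘ suc))

  minimum-lower : ∀ {k} .{{_ : NonZero k}} (x : Vector Carrier k) i → minimum x ≤ x i
  minimum-lower {suc k} x = λ { zero → base (x ∘ suc) ; (suc i) → step (x ∘ suc) i }
    where
    base : ∀ {l} (u : Vector Carrier l) → Vector.foldr _⊓_ (x zero) u ≤ x zero
    base {zero}  u = ≤-refl
    base {suc l} u = ≤-trans (proj₁ (proj₂ (⊓-infimum _ _))) (base (u ∘ suc))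
    step : ∀ {l} (u : Vector Carrier l) i → Vector.foldr _⊓_ (x zero) u ≤ u i
    step u zero    = proj₁ (⊓-infimum _ _)
    step u (suc i) = ≤-trans (proj₁ (proj₂ (⊓-infimum _ _))) (step (u ∘ suc) i)

  minimum-greatest : ∀ {k} .{{_ : NonZero k}} (x : Vector Carrier k) {v} → (∀ i → v ≤ x i) →
                     v ≤ minimum x
  minimum-greatest {suc k} x {v} v≤x = go (x ∘ suc) (v≤x ∘ suc)
    where
    go : ∀ {l} (u : Vector Carrier l) → (∀ i → v ≤ u i) → v ≤ Vector.foldr _⊓_ (x zero) u
    go {zero}  u v≤u = v≤x zero
    go {suc l} u v≤u = proj₂ (proj₂ (⊓-infimum _ _)) v (v≤u zero) (go (u ∘ suc) (v≤u ∘ suc))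

  open SemiringMult R.semiring using (×-homo-+; ×1-homo-*)

  fromℕ-+ : ∀ m n → fromℕ (m ℕ.+ n) ≈ fromℕ m + fromℕ n
  fromℕ-+ = ×-homo-+ 1#

  fromℕ-* : ∀ m n → fromℕ (m ℕ.* n) ≈ fromℕ m * fromℕ n
  fromℕ-* = ×1-homo-*

  0≤fromℕ : ∀ n → 0# ≤ fromℕ n
  0≤fromℕ zero    = ≤-refl
  0≤fromℕ (suc n) = <⇒≤ (0<fromℕ (suc n))

  fromℕ-mono-≤ : ∀ {m n} → m ℕ.≤ n → fromℕ m ≤ fromℕ n
  fromℕ-mono-≤ {n = n} z≤n = 0≤fromℕ n
  fromℕ-mono-≤ (s≤s m≤n) = +-monoʳ-≤ 1# (fromℕ-mono-≤ m≤n)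

-- Makespans of natural-valued scenarios, and expectations over random schedules.

module Loads {c ℓ₁ ℓ₂} (ℝ : RealNumbers c ℓ₁ ℓ₂) where
  open RealNumbers ℝ
  open RealProperties ℝ
  open Scheduling ℝ
  open Order ℝ
  open NatLoad using (loadℕ)
  open SemiringSum R.semiring using (*-distribˡ-sum; *-distribʳ-sum; ∑-distrib-+; sum-cong-≋)

  minSchedule-lower : ∀ {m n} .{{_ : NonZero m}} (f : Schedule m n → Carrier) S →
                      minSchedule f ≤ f S
  minSchedule-lower f Vec.[]      = ≤-refl
  minSchedule-lower f (i Vec.∷ S) =
    ≤-trans (minimum-lower _ i) (minSchedule-lower (λ S → f (i Vec.∷ S)) S)

  minSchedule-greatest : ∀ {m n} .{{_ : NonZero m}} (f : Schedule m n → Carrier) {v} →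
                         (∀ S → v ≤ f S) → v ≤ minSchedule f
  minSchedule-greatest {n = zero}  f v≤f = v≤f Vec.[]
  minSchedule-greatest {n = suc n} f v≤f =
    minimum-greatest _ (λ i → minSchedule-greatest (λ S → f (i Vec.∷ S)) (λ S → v≤f (i Vec.∷ S)))

  load-fromℕ : ∀ {m n} (S : Schedule m n) (w : Vector ℕ n) i →
               load S (fromℕ ∘ w) i ≈ fromℕ (loadℕ (Vec.lookup S) w i)
  load-fromℕ S w i = go (λ j → ⌊ Vec.lookup S j ≟ i ⌋) w
    where
    -- Membership in machine `i` is generalised to an arbitrary Boolean test, so the induction over
    -- jobs no longer mentions `S`.
    go : ∀ {n} (b : Fin n → Bool) (w : Vector ℕ n) →
         sum (λ j → if b j then fromℕ (w j) else 0#) ≈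
         fromℕ (NatLoad.sum (λ j → if b j then w j else 0))
    go {zero}  b w = refl
    go {suc n} b w = trans (+-cong (if-fromℕ (b zero)) (go (b ∘ suc) (w ∘ suc)))
                           (sym (fromℕ-+ (if b zero then w zero else 0) _))
      where
      if-fromℕ : ∀ t → (if t then fromℕ (w zero) else 0#) ≈ fromℕ (if t then w zero else 0)
      if-fromℕ true  = refl
      if-fromℕ false = refl

  Cmax-lower : ∀ {m n} .{{_ : NonZero m}} (S : Schedule m n) (w : Vector ℕ n) {x} i →
               x ℕ.≤ loadℕ (Vec.lookup S) w i → fromℕ x ≤ Cmax S (fromℕ ∘ w)
  Cmax-lower S w i x≤load = ≤-trans (fromℕ-mono-≤ x≤load)
    (≤-trans (≤-reflexive (sym (load-fromℕ S w i))) (maximum-upper (load S (fromℕ ∘ w)) i))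

  Cmax-upper : ∀ {m n} .{{_ : NonZero m}} (a : Vector (Fin m) n) (w : Vector ℕ n) {x} →
               (∀ i → loadℕ a w i ℕ.≤ x) → Cmax (Vec.tabulate a) (fromℕ ∘ w) ≤ fromℕ x
  Cmax-upper a w load≤x = maximum-least (load (Vec.tabulate a) (fromℕ ∘ w)) λ i →
    ≤-trans (≤-reflexive (load-fromℕ (Vec.tabulate a) w i))
      (fromℕ-mono-≤ (ℕ.≤-trans
        (ℕ.≤-reflexive (NatLoad.loadℕ-cong (lookup∘tabulate a) (λ _ → ≡.refl) i)) (load≤x i)))

  -- Nonnegative weights of total mass one preserve a bound valid for every schedule, and linearity
  -- of expectation then separates the two makespans.
  𝔼-linear-lower : ∀ {m n} (X : RandomSchedule m n) f g x {v} → (∀ S → v ≤ f S + x * g S) →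
                   v ≤ 𝔼 X f + x * 𝔼 X g
  𝔼-linear-lower X f g x {v} v≤ = begin
    v                                                ≈⟨ *-identityˡ v ⟨
    1# * v                                           ≈⟨ *-congʳ (sum≈1 X) ⟨
    sum (prob X) * v                                 ≈⟨ *-distribʳ-sum v (prob X) ⟩
    sum (λ ω → prob X ω * v)
      ≤⟨ sum-mono-≤ (λ ω → *-monoʳ-≤ (0≤prob X ω) (v≤ _)) ⟩
    sum (λ ω → prob X ω * (f (σ ω) + x * g (σ ω)))
      ≈⟨ sum-cong-≋ (λ ω → rearrange (prob X ω) (f (σ ω)) x (g (σ ω))) ⟩
    sum (λ ω → prob X ω * f (σ ω) + x * (prob X ω * g (σ ω)))
      ≈⟨ ∑-distrib-+ (λ ω → prob X ω * f (σ ω)) _ ⟩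
    𝔼 X f + sum (λ ω → x * (prob X ω * g (σ ω)))
      ≈⟨ +-congˡ (*-distribˡ-sum x (λ ω → prob X ω * g (σ ω))) ⟨
    𝔼 X f + x * 𝔼 X g                                ∎
    where
    open ≤-Reasoning
    σ = schedule X
    open RingSolver R.commutativeSemiring
    rearrange : ∀ p f x g → p * (f + x * g) ≈ p * f + x * (p * g)
    rearrange = solve 4 (λ p f x g → p :* (f :+ x :* g) := p :* f :+ x :* (p :* g)) refl

-- The hard instance: its two optima and the trade-off every schedule faces.

module HardInstance {c ℓ₁ ℓ₂} (ℝ : RealNumbers c ℓ₁ ℓ₂) (r k′ : ℕ) (k≤r : suc k′ ℕ.≤ r) where
  open RealNumbers ℝ
  open RealProperties ℝ
  open Scheduling ℝ
  open Order ℝ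
  open Loads ℝ
  open NatLoad

  -- `M` is the total size of the `r` big jobs, so stacking all of them on one machine costs exactly
  -- as much as one small job at its upper bound.
  k M : ℕ
  k = suc k′
  M = r ℕ.* k

  1≤r : 1 ℕ.≤ r
  1≤r = ℕ.≤-trans (s≤s z≤n) k≤r

  k≤M : k ℕ.≤ M
  k≤M = ℕ.≤-trans (ℕ.≤-reflexive (≡.sym (ℕ.*-identityˡ k))) (ℕ.*-monoˡ-≤ k 1≤r)

  -- The first `k` entries are the small jobs; the last `r` are the big jobs, whose intervals are
  -- single points. `low` also serves as the prediction.
  low high : Vector ℕ (k ℕ.+ r)
  low  = replicate k 1 ++ replicate r k
  high = replicate k M ++ replicate r k

  low≤high : ∀ j → low j ℕ.≤ high j
  low≤high j with splitAt k j
  ... | inj₁ _ = ℕ.≤-trans (s≤s z≤n) k≤M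
  ... | inj₂ _ = ℕ.≤-refl

  U : IntervalSet (k ℕ.+ r)
  U = record
    { p⁻    = fromℕ ∘ low
    ; p⁺    = fromℕ ∘ high
    ; 0≤p⁻  = λ j → 0≤fromℕ (low j)
    ; p⁻≤p⁺ = λ j → fromℕ-mono-≤ (low≤high j)
    }

  p⁻∈U : p⁻ U ∈ U
  p⁻∈U j = ≤-refl , p⁻≤p⁺ U j

  p⁺∈U : p⁺ U ∈ U
  p⁺∈U j = p⁻≤p⁺ U j , ≤-refl

  module _ (S : Schedule (suc r) (k ℕ.+ r)) where
    private
      a : Vector (Fin (suc r)) k
      a = Vec.lookup S ∘ (_↑ˡ r)
      b : Vector (Fin (suc r)) r
      b = Vec.lookup S ∘ (k ↑ʳ_)

    -- A single big job already has size `k`, and one exists because `r` is positive.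
    k≤Cmax⁻ : fromℕ k ≤ Cmax S (p⁻ U)
    k≤Cmax⁻ = Cmax-lower S low _ (ℕ.≤-trans
      (ℕ.≤-reflexive (≡.sym (lookup-++ʳ (replicate k 1) (replicate r k) j)))
      (job≤loadℕ (Vec.lookup S) low (k ↑ʳ j) ≡.refl))
      where
      j : Fin r
      j = fromℕ< 1≤r

    M≤Cmax⁺ : fromℕ M ≤ Cmax S (p⁺ U)
    M≤Cmax⁺ = Cmax-lower S high _ (job≤loadℕ (Vec.lookup S) high zero ≡.refl)

    -- Avoiding a predicted load of `suc k` forces all `k` small jobs onto one machine, where each
    -- of them can grow to `M`.
    dichotomy : fromℕ (suc k) ≤ Cmax S (p⁻ U) ⊎ fromℕ (k ℕ.* M) ≤ Cmax S (p⁺ U)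
    dichotomy with overload⊎concentrated a b
    ... | inj₁ (i , over) = inj₁ (Cmax-lower S low i (ℕ.≤-trans over
            (ℕ.≤-reflexive (≡.sym (loadℕ-++ (Vec.lookup S) (replicate k 1) (replicate r k) i)))))
    ... | inj₂ conc = inj₂ (Cmax-lower S high (a zero) (ℕ.≤-trans
            (ℕ.≤-trans (ℕ.≤-reflexive (≡.sym (loadℕ-concentrated a M conc))) (ℕ.m≤m+n _ _))
            (ℕ.≤-reflexive (≡.sym
              (loadℕ-++ (Vec.lookup S) (replicate k M) (replicate r k) (a zero))))))

  loadℕ-assign : ∀ (a : Vector (Fin (suc r)) k) (b : Vector (Fin (suc r)) r) u v i →
                 loadℕ (a ++ b) (u ++ v) i ≡ loadℕ a u i ℕ.+ loadℕ b v i
  loadℕ-assign a b u v i = ≡.trans (loadℕ-++ (a ++ b) u v i)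
    (cong₂ ℕ._+_ (loadℕ-cong {u = u} (lookup-++ˡ a b) (λ _ → ≡.refl) i)
                 (loadℕ-cong {u = v} (lookup-++ʳ a b) (λ _ → ≡.refl) i))

  -- Attained with all small jobs on machine `zero` and one big job on each of the other `r`
  -- machines.
  OPT≈k : OPT (suc r) (p⁻ U) ≈ fromℕ k
  OPT≈k = ≤-antisym
    (≤-trans (minSchedule-lower (λ S → Cmax S (p⁻ U)) (Vec.tabulate balanced))
             (Cmax-upper balanced low λ i →
               ℕ.≤-trans (ℕ.≤-reflexive (loadℕ-assign (const zero) suc _ _ i)) (bound i)))
    (minSchedule-greatest (λ S → Cmax S (p⁻ U)) k≤Cmax⁻)
    where
    balanced : Vector (Fin (suc r)) (k ℕ.+ r)
    balanced = const zero ++ suc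
    bound : ∀ i → loadℕ {n = k} (const zero) (const 1) i ℕ.+ loadℕ {n = r} suc (const k) i ℕ.≤ k
    bound zero = ℕ.≤-trans (ℕ.+-mono-≤ (loadℕ-const≤ {suc r} {k} (const zero) 1 zero)
                               (ℕ.≤-reflexive (loadℕ-miss {n = r} suc (const k) {zero} (λ _ ()))))
                   (ℕ.≤-reflexive (≡.trans (ℕ.+-identityʳ _) (ℕ.*-identityʳ k)))
    bound (suc i) = ℕ.+-mono-≤
      (ℕ.≤-reflexive (loadℕ-miss {n = k} (const zero) (const 1) {suc i} (λ _ ())))
      (loadℕ-injective {n = r} suc k (suc i) suc-injective)

  -- Attained with all big jobs on machine `zero` and the small jobs on distinct other machines, of
  -- which there are enough by `k≤r`. The worst case of a schedule unfolds to its makespan at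
  -- `p⁺ U`.
  OPTʳᵒᵇ≈M : OPTʳᵒᵇ (suc r) U ≈ fromℕ M
  OPTʳᵒᵇ≈M = ≤-antisym
    (≤-trans (minSchedule-lower (λ S → Cmax S (p⁺ U)) (Vec.tabulate separated))
             (Cmax-upper separated high λ i →
               ℕ.≤-trans (ℕ.≤-reflexive (loadℕ-assign spread (const zero) _ _ i)) (bound i)))
    (minSchedule-greatest (λ S → Cmax S (p⁺ U)) M≤Cmax⁺)
    where
    spread : Vector (Fin (suc r)) k
    spread j = suc (inject≤ j k≤r)
    separated : Vector (Fin (suc r)) (k ℕ.+ r)
    separated = spread ++ const zero
    bound : ∀ i → loadℕ spread (const M) i ℕ.+ loadℕ {n = r} (const zero) (const k) i ℕ.≤ M
    bound zero = ℕ.+-mono-≤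
      (ℕ.≤-reflexive (loadℕ-miss spread (const M) {zero} (λ _ ())))
      (loadℕ-const≤ {suc r} {r} (const zero) k zero)
    bound (suc i) = ℕ.≤-trans (ℕ.+-mono-≤
      (loadℕ-injective spread M (suc i) (inject≤-injective k≤r k≤r _ _ ∘ suc-injective))
      (ℕ.≤-reflexive (loadℕ-miss {n = r} (const zero) (const k) {suc i} (λ _ ()))))
      (ℕ.≤-reflexive (ℕ.+-identityʳ M))

  -- Linear in the two makespans, so that it survives taking expectations.
  tradeoff : ∀ S → fromℕ (M ℕ.* (k ℕ.* k)) ≤
                   Cmax S (p⁺ U) + fromℕ (M ℕ.* k′) * Cmax S (p⁻ U)
  tradeoff S = [ (λ k<C⁻ → combine M (suc k) overloaded (M≤Cmax⁺ S) k<C⁻)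
               , (λ kM≤C⁺ → combine (k ℕ.* M) k concentrated kM≤C⁺ (k≤Cmax⁻ S)) ]′ (dichotomy S)
    where
    open +-*-Solver
    -- The weight for which both branches of the dichotomy give exactly M k²: M + M (k - 1)(k + 1)
    -- in the first, k M + M (k - 1) k in the second.
    e = M ℕ.* k′
    overloaded : M ℕ.* (k ℕ.* k) ≡ M ℕ.+ e ℕ.* suc k
    overloaded = solve 2 (λ M k′ → let k = con 1 :+ k′ in
      M :* (k :* k) := M :+ (M :* k′) :* (con 1 :+ k)) ≡.refl M k′
    concentrated : M ℕ.* (k ℕ.* k) ≡ k ℕ.* M ℕ.+ e ℕ.* k
    concentrated = solve 2 (λ M k′ → let k = con 1 :+ k′ in
      M :* (k :* k) := k :* M :+ (M :* k′) :* k) ≡.refl M k′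

    combine : ∀ x y {z C⁺ C⁻} → z ≡ x ℕ.+ e ℕ.* y → fromℕ x ≤ C⁺ → fromℕ y ≤ C⁻ →
              fromℕ z ≤ C⁺ + fromℕ e * C⁻
    combine x y {C⁺ = C⁺} {C⁻} ≡.refl x≤C⁺ y≤C⁻ = begin
      fromℕ (x ℕ.+ e ℕ.* y)         ≈⟨ fromℕ-+ x (e ℕ.* y) ⟩
      fromℕ x + fromℕ (e ℕ.* y)     ≈⟨ +-congˡ (fromℕ-* e y) ⟩
      fromℕ x + fromℕ e * fromℕ y   ≤⟨ +-mono-≤ x≤C⁺ (*-monoʳ-≤ (0≤fromℕ e) y≤C⁻) ⟩
      C⁺ + fromℕ e * C⁻             ∎
      where open ≤-Reasoning

  0<M : 0# < fromℕ M
  0<M = <-≤-trans (0<fromℕ k) (fromℕ-mono-≤ k≤M)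

-- The deterministic and randomized lower bounds.

module LowerBounds {c ℓ₁ ℓ₂} (ℝ : RealNumbers c ℓ₁ ℓ₂) where
  open RealNumbers ℝ
  open RealProperties ℝ
  open Scheduling ℝ
  open Order ℝ
  open Loads ℝ
  open Halving
  open RingSolver R.commutativeSemiring using (solve; _:+_; _:*_; _:=_)

  module _ (r l′ : ℕ) (l≤r : suc l′ ℕ.≤ r) {α : Carrier} (α< : α < 1# + recip (suc l′)) where
    private
      l = suc l′
      m = suc r
      L = fromℕ l

    -- The bound on α with its denominator cleared; this is the only form in which it is used below.
    L*α<L+1 : L * α < fromℕ (suc l)
    L*α<L+1 = begin-strict
      L * α                 <⟨ *-monoʳ-< (0<fromℕ l) α< ⟩
      L * (1# + recip l)    ≈⟨ distribˡ L 1# (recip l) ⟩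
      L * 1# + L * recip l  ≈⟨ +-cong (*-identityʳ L) (fromℕ*recip≈1 l) ⟩
      L + 1#                ≈⟨ +-comm L 1# ⟩
      fromℕ (suc l)         ∎
      where open ≤-Reasoning

    deterministic : ∀ β → β < L → ¬ (∃ λ (A : DetAlgorithm m) → Consistent α A × Robust β A)
    deterministic β β<L (A , consistent , robust) =
      -- Each branch of the dichotomy is an inequality `≤`, hence a function refuting the reverse
      -- strict one. Consistency supplies that strict inequality in the first branch, robustness in
      -- the second.
      [ (λ overloaded → overloaded (begin-strict
          Cmax S (p⁻ U)       ≤⟨ consistent U (p⁻ U) p⁻∈U ⟩
          α * OPT m (p⁻ U)    ≈⟨ *-congˡ OPT≈k ⟩
          α * L               ≈⟨ *-comm α L ⟩
          L * α               <⟨ L*α<L+1 ⟩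
          fromℕ (suc l)       ∎))
      , (λ concentrated → concentrated (begin-strict
          Cmax S (p⁺ U)       ≤⟨ robust U (p⁻ U) p⁻∈U ⟩
          β * OPTʳᵒᵇ m U      ≈⟨ *-congˡ OPTʳᵒᵇ≈M ⟩
          β * fromℕ M         ≈⟨ *-comm β (fromℕ M) ⟩
          fromℕ M * β         <⟨ *-monoʳ-< 0<M β<L ⟩
          fromℕ M * L         ≈⟨ *-comm (fromℕ M) L ⟩
          L * fromℕ M         ≈⟨ fromℕ-* l M ⟨
          fromℕ (l ℕ.* M)     ∎)) ]′ (dichotomy S)
      where
      open HardInstance ℝ r l′ l≤r
      open ≤-Reasoning
      S : Schedule m (l ℕ.+ r)
      S = A _ U (p⁻ U) p⁻∈U

    -- Bounding the expectations in the trade-off gives M k² ≤ β M + M (k - 1) α k < M λ / 4 + M k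
    -- (k - 1)(λ + 1) / λ, and the numerical hypothesis bounds the right side by M k² again. The
    -- chain is multiplied by 4 λ throughout, to stay free of division.
    randomized-at : ∀ k′ → suc k′ ℕ.≤ r →
      l ℕ.* l ℕ.+ 4 ℕ.* (suc k′ ℕ.* (k′ ℕ.* suc l)) ℕ.≤ 4 ℕ.* (l ℕ.* (suc k′ ℕ.* suc k′)) →
      ∀ β → β < L * recip 4 →
      ¬ (∃ λ (A : RandAlgorithm m) → ConsistentInExpectation α A × RobustInExpectation β A)
    randomized-at k′ k≤r k-suffices β β< (A , consistent , robust) = ≤-refl (begin-strict
      Q * (L * (W * (K * K)))
        ≈⟨ *-congˡ (*-congˡ (trans (fromℕ-* M (k ℕ.* k)) (*-congˡ (fromℕ-* k k)))) ⟨
      Q * (L * fromℕ (M ℕ.* (k ℕ.* k)))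
        ≤⟨ *-monoʳ-≤ 0≤Q (*-monoʳ-≤ 0≤L
             (𝔼-linear-lower X (λ S → Cmax S (p⁺ U)) (λ S → Cmax S (p⁻ U)) _ tradeoff)) ⟩
      Q * (L * (𝔼 X (λ S → Cmax S (p⁺ U)) + fromℕ (M ℕ.* k′) * 𝔼 X (λ S → Cmax S (p⁻ U))))
        ≤⟨ *-monoʳ-≤ 0≤Q (*-monoʳ-≤ 0≤L (+-mono-≤
             (robust U (p⁻ U) p⁻∈U (p⁺ U) p⁺∈U)
             (*-monoʳ-≤ (0≤fromℕ (M ℕ.* k′)) (consistent U (p⁻ U) p⁻∈U)))) ⟩
      Q * (L * (β * OPTʳᵒᵇ m U + fromℕ (M ℕ.* k′) * (α * OPT m (p⁻ U))))
        ≈⟨ *-congˡ (*-congˡ (+-cong (*-congˡ OPTʳᵒᵇ≈M) (*-cong (fromℕ-* M k′) (*-congˡ OPT≈k)))) ⟩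
      Q * (L * (β * W + W * K′ * (α * K)))
        ≈⟨ solve 7 (λ Q L W K K′ α β →
             Q :* (L :* (β :* W :+ W :* K′ :* (α :* K))) :=
             (L :* W) :* (Q :* β) :+ W :* (Q :* (K :* K′)) :* (L :* α)) refl Q L W K K′ α β ⟩
      (L * W) * (Q * β) + W * (Q * (K * K′)) * (L * α)
        -- Strictness has to come from β: for k = 1 the coefficient of `L * α` is zero, so the bound
        -- on α can only contribute a weak inequality.
        <⟨ +-monoˡ-< _ (*-monoʳ-< (*-pos (0<fromℕ l) 0<M) Qβ<L) ⟩
      (L * W) * L + W * (Q * (K * K′)) * (L * α)
        ≤⟨ +-monoʳ-≤ _ (*-monoʳ-≤ 0≤WQKK′ (<⇒≤ L*α<L+1)) ⟩
      (L * W) * L + W * (Q * (K * K′)) * N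
        ≈⟨ solve 6 (λ Q L W K K′ N →
             (L :* W) :* L :+ W :* (Q :* (K :* K′)) :* N :=
             W :* (L :* L :+ Q :* (K :* (K′ :* N)))) refl Q L W K K′ N ⟩
      W * (L * L + Q * (K * (K′ * N)))
        ≈⟨ *-congˡ (+-cong (fromℕ-* l l) (trans (fromℕ-* 4 (k ℕ.* (k′ ℕ.* suc l)))
             (*-congˡ (trans (fromℕ-* k (k′ ℕ.* suc l)) (*-congˡ (fromℕ-* k′ (suc l))))))) ⟨
      W * (fromℕ (l ℕ.* l) + fromℕ (4 ℕ.* (k ℕ.* (k′ ℕ.* suc l))))
        ≈⟨ *-congˡ (fromℕ-+ (l ℕ.* l) (4 ℕ.* (k ℕ.* (k′ ℕ.* suc l)))) ⟨
      W * fromℕ (l ℕ.* l ℕ.+ 4 ℕ.* (k ℕ.* (k′ ℕ.* suc l)))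
        ≤⟨ *-monoʳ-≤ (0≤fromℕ M) (fromℕ-mono-≤ k-suffices) ⟩
      W * fromℕ (4 ℕ.* (l ℕ.* (k ℕ.* k)))
        ≈⟨ *-congˡ (trans (fromℕ-* 4 (l ℕ.* (k ℕ.* k)))
             (*-congˡ (trans (fromℕ-* l (k ℕ.* k)) (*-congˡ (fromℕ-* k k))))) ⟩
      W * (Q * (L * (K * K)))
        ≈⟨ solve 4 (λ Q L W K →
             W :* (Q :* (L :* (K :* K))) := Q :* (L :* (W :* (K :* K)))) refl Q L W K ⟩
      Q * (L * (W * (K * K))) ∎)
      where
      open HardInstance ℝ r k′ k≤r
      open ≤-Reasoning
      X : RandomSchedule m (k ℕ.+ r)
      X = A _ U (p⁻ U) p⁻∈U
      Q = fromℕ 4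
      W = fromℕ M
      K = fromℕ k
      K′ = fromℕ k′
      N = fromℕ (suc l)
      0≤Q : 0# ≤ Q
      0≤Q = 0≤fromℕ 4
      0≤L : 0# ≤ L
      0≤L = 0≤fromℕ l
      0≤WQKK′ : 0# ≤ W * (Q * (K * K′))
      0≤WQKK′ = ≤-trans (0≤fromℕ (M ℕ.* (4 ℕ.* (k ℕ.* k′)))) (≤-reflexive
        (trans (fromℕ-* M (4 ℕ.* (k ℕ.* k′)))
          (*-congˡ (trans (fromℕ-* 4 (k ℕ.* k′)) (*-congˡ (fromℕ-* k k′))))))
      Qβ<L : Q * β < L
      Qβ<L = begin-strict
        Q * β                <⟨ *-monoʳ-< (0<fromℕ 4) β< ⟩
        Q * (L * recip 4)
          ≈⟨ solve 3 (λ Q L R → Q :* (L :* R) := L :* (Q :* R)) refl Q L (recip 4) ⟩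
        L * (Q * recip 4)    ≈⟨ *-congˡ (fromℕ*recip≈1 4) ⟩
        L * 1#               ≈⟨ *-identityʳ L ⟩
        L                    ∎

    randomized : ∀ β → β < L * recip 4 →
      ¬ (∃ λ (A : RandAlgorithm m) → ConsistentInExpectation α A × RobustInExpectation β A)
    randomized =
      -- The chosen k is at most λ, hence at most `r`, so the instance with this k exists.
      let k′ , k′≤l′ , k-suffices = half-suffices l′
      in randomized-at k′ (ℕ.≤-trans (s≤s k′≤l′) l≤r) k-suffices

theorem5 : ∀ {c ℓ₁ ℓ₂} (ℝ : RealNumbers c ℓ₁ ℓ₂) →
  let open RealNumbers ℝ
      open RealProperties ℝ using (recip)
      open Scheduling ℝ
  in
  ∀ (m l : ℕ) .{{_ : NonZero m}} .{{_ : NonZero l}} →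
  2 ℕ.≤ m → 1 ℕ.≤ l → l ℕ.≤ m ℕ.∸ 1 →
  ∀ (α : Carrier) → α < 1# + recip l →
    (∀ (β : Carrier) → β < fromℕ l →
       ¬ (∃ λ (A : DetAlgorithm m) → Consistent α A × Robust β A))
  × (∀ (β : Carrier) → β < fromℕ l * recip 4 →
       ¬ (∃ λ (A : RandAlgorithm m) → ConsistentInExpectation α A × RobustInExpectation β A))
-- With m = r + 1 the hypothesis λ ≤ m - 1 computes to λ ≤ r, the number of big jobs.
theorem5 ℝ (suc r) (suc l′) _ _ l≤r α α< =
  LowerBounds.deterministic ℝ r l′ l≤r α< , LowerBounds.randomized ℝ r l′ l≤r α<
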